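{- For every positive integer $n$, $a(n)\ge 0$, with equality if and only if $n=1$ or $n=2$.
   Context: For a positive integer $n$, $a(n)$ is the signed number of partitions of $n$ into exactly two distinct part sizes, each occurring an odd number of times: $$a(n)=\sum (-1)^{r_1+r_2},$$ the sum being over all quadruples of integers $(x,y,r_1,r_2)$ with $1\le x<y$, $r_1,r_2\ge 0$ and $(2r_1+1)x+(2r_2+1)y=n$. -}

module Defs where

open import Data.Integer.Base as ℤ using (ℤ; 0ℤ; -1ℤ)
open import Data.List.Base using (List; map; foldr; filter; upTo; cartesianProduct)
open import Data.List.Membership.Propositional using (_∈_)
open import Data.List.Membership.Propositional.Properties using (∈-cartesianProduct⁺; ∈-upTo⁺; ∈-filter⁺; ∈-filter⁻)
open import Data.List.Relation.Unary.Unique.Propositional using (Unique)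
import Data.List.Relation.Unary.Unique.Propositional.Properties as Unique
open import Data.Nat.Base using (ℕ; suc; _+_; _*_; _≤_; _<_; s≤s; >-nonZero)
open import Data.Nat.Properties using (_≟_; _≤?_; _<?_; ≤-trans; ≤-reflexive; <⇒≤; m≤m+n; m≤n+m; m≤m*n; m≤n*m)
open import Data.Product.Base using (_×_; _,_; proj₂)
open import Function.Bundles using (_⇔_; mk⇔)
open import Relation.Binary.PropositionalEquality.Core using (_≡_)
open import Relation.Nullary.Decidable using (_×-dec_)
open import Relation.Unary using (Decidable)

-- (x , y , r₁ , r₂): part sizes x and y with multiplicities 2r₁+1 and 2r₂+1.
Quadruple : Set
Quadruple = ℕ × ℕ × ℕ × ℕ

Admissible : ℕ → Quadruple → Set
Admissible n (x , y , r₁ , r₂) =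
  1 ≤ x × x < y × (2 * r₁ + 1) * x + (2 * r₂ + 1) * y ≡ n

admissible? : ∀ n → Decidable (Admissible n)
admissible? n (x , y , r₁ , r₂) =
  (1 ≤? x) ×-dec (x <? y) ×-dec ((2 * r₁ + 1) * x + (2 * r₂ + 1) * y ≟ n)

-- All four entries of an admissible quadruple are at most n, so searching this
-- box loses nothing; see ∈-quadruples⇔ and quadruples-unique.
box : ℕ → List Quadruple
box n = cartesianProduct range (cartesianProduct range (cartesianProduct range range))
  where
  range : List ℕ
  range = upTo (suc n)

quadruples : ℕ → List Quadruple
quadruples n = filter (admissible? n) (box n)

sign : Quadruple → ℤ
sign (x , y , r₁ , r₂) = -1ℤ ℤ.^ (r₁ + r₂)

a : ℕ → ℤ
a n = foldr ℤ._+_ 0ℤ (map sign (quadruples n))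

quadruples-unique : ∀ n → Unique (quadruples n)
quadruples-unique n = Unique.filter⁺ (admissible? n)
  (Unique.cartesianProduct⁺ u (Unique.cartesianProduct⁺ u (Unique.cartesianProduct⁺ u u)))
  where
  u : Unique (upTo (suc n))
  u = Unique.upTo⁺ (suc n)

private
  part≤ : ∀ r x → x ≤ (2 * r + 1) * x
  part≤ r x = m≤n*m x (2 * r + 1) {{>-nonZero (m≤n+m 1 (2 * r))}}

  rep≤ : ∀ r x → 1 ≤ x → r ≤ (2 * r + 1) * x
  rep≤ r x 1≤x = ≤-trans (≤-trans (m≤n*m r 2) (m≤m+n (2 * r) 1))
                         (m≤m*n (2 * r + 1) x {{>-nonZero 1≤x}})

  admissible⇒∈box : ∀ n q → Admissible n q → q ∈ box n
  admissible⇒∈box n (x , y , r₁ , r₂) (1≤x , x<y , eq) =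
    ∈-cartesianProduct⁺ (left (part≤ r₁ x))
      (∈-cartesianProduct⁺ (right (part≤ r₂ y))
        (∈-cartesianProduct⁺ (left (rep≤ r₁ x 1≤x))
                             (right (rep≤ r₂ y (≤-trans 1≤x (<⇒≤ x<y))))))
    where
    A = (2 * r₁ + 1) * x
    B = (2 * r₂ + 1) * y
    left : ∀ {k} → k ≤ A → k ∈ upTo (suc n)
    left k≤A = ∈-upTo⁺ (s≤s (≤-trans k≤A (≤-trans (m≤m+n A B) (≤-reflexive eq))))
    right : ∀ {k} → k ≤ B → k ∈ upTo (suc n)
    right k≤B = ∈-upTo⁺ (s≤s (≤-trans k≤B (≤-trans (m≤n+m B A) (≤-reflexive eq))))

∈-quadruples⇔ : ∀ n q → q ∈ quadruples n ⇔ Admissible n q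
∈-quadruples⇔ n q = mk⇔
  (λ q∈ → proj₂ (∈-filter⁻ (admissible? n) {xs = box n} q∈))
  (λ adm → ∈-filter⁺ (admissible? n) (admissible⇒∈box n q adm) adm)

{-# OPTIONS --safe #-}
module Submission where

-- A Liouville-style elementary argument. Let S be the signed sum over all
-- solutions of (2r+1)x + (2s+1)y = n with x, y ≥ 1 (no order imposed), and weight
-- solutions of 2jx + (2s+1)z = n with j, x, z ≥ 1 by (-1)^j.
--
-- Putting y = x + z, j = r + s + 1 gives a(n) = -∑[s < j]; putting z = x + y,
-- j = r - s turns the part r > s of S into ∑[x < z]; and (s, x) ↦ (s - j, x + z)
-- gives ∑[s ≥ j] = ∑[x > z]. Hence -a(n) = ∑[x < z] + ∑[x = z]. Splitting S
-- by comparing x with y, and r with s, gives 2a(n) + X = 2∑[x < z] + D, where X and D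
-- are its parts x = y and r = s. Therefore 4a(n) = D - X - 2∑[x = z].
--
-- Here ∑[x = z] ≤ 0 by (j, s) ↦ (j - 1, s + 1) for even j. The positive
-- terms of X (r + s even) inject, for x odd, into the terms of D with both parts odd,
-- and, for x even, into the negative terms of X. If n ≥ 3, the term of D
-- coming from n = 2 + (n - 2) is missed, so X < D.

open import Defs
open import Data.Integer.Base as ℤ using (ℤ; 0ℤ; 1ℤ; -1ℤ)
import Data.Integer.Properties as ℤ
import Data.Integer.Tactic.RingSolver as ℤ-Ring
open import Algebra.Properties.AbelianGroup ℤ.+-0-abelianGroup using (∙-cancelʳ)
open import Data.List.Base using (List; []; _∷_; _++_; map; foldr; filter)
open import Data.List.Membership.Propositional using (_∈_)
open import Data.List.Membership.Propositional.Properties using (∈-++⁺ˡ; ∈-++⁺ʳ; ∈-++⁻; ∈-map⁺; ∈-map⁻; ∈-filter⁺; ∈-filter⁻; ∈-cartesianProduct⁺; ∈-upTo⁺)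
import Data.List.Membership.DecPropositional as DecMembership
open import Data.List.Properties using (map-∘; map-cong-local)
open import Data.List.Relation.Binary.Permutation.Propositional using (↭⇒↭ₛ)
open import Data.List.Relation.Binary.Permutation.Propositional.Properties using (map⁺)
import Data.List.Relation.Binary.Permutation.Setoid.Properties as ↭ₛ
open import Data.List.Relation.Binary.BagAndSetEquality using (∼bag⇒↭)
open import Data.List.Membership.Propositional.Properties.WithK using (unique∧set⇒bag)
open import Data.List.Relation.Unary.All as All using (All)
import Data.List.Relation.Unary.All.Properties as All
open import Data.List.Relation.Unary.AllPairs using ([]; _∷_)
open import Data.List.Relation.Unary.Any using (here; there)
open import Data.List.Relation.Unary.Unique.Propositional using (Unique)
import Data.List.Relation.Unary.Unique.Propositional.Properties as Unique
open import Data.Nat.Base using (ℕ; zero; suc; _+_; _*_; _∸_; _≤_; _<_; z≤n; s≤s; ⌊_/2⌋; >-nonZero)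
open import Data.Nat.Properties
open import Data.Nat.Tactic.RingSolver using (solve-∀)
open import Data.Product.Base using (_×_; _,_; proj₁; proj₂; ∃)
open import Data.Product.Properties using (≡-dec)
open import Data.Sum.Base using (_⊎_; inj₁; inj₂)
open import Function.Base using (_∘_; id)
open import Function.Bundles using (_⇔_; mk⇔; Equivalence)
open import Relation.Binary.Definitions using (DecidableEquality)
open import Relation.Binary.PropositionalEquality
open import Relation.Nullary using (¬_; yes; no; contradiction)
open import Relation.Nullary.Decidable using (_×-dec_)
open import Relation.Unary using (Decidable; _∩_)
open import Relation.Unary.Properties using (∁?)

private
  variable
    A B : Set
    P R : A → Set

-- Sums over finite sets

-- A finite set is carried by its predicate; the list is a duplicate-free witness whose order does
-- not affect `∑`. Sums can then be compared by reasoning about predicates alone.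
record Enumeration (P : A → Set) : Set where
  field
    list   : List A
    unique : Unique list
    member : ∀ x → x ∈ list ⇔ P x

  sound : ∀ {x} → x ∈ list → P x
  sound = Equivalence.to (member _)

  complete : ∀ {x} → P x → x ∈ list
  complete = Equivalence.from (member _)

open Enumeration

_∣_ : Enumeration P → Decidable R → Enumeration (P ∩ R)
(e ∣ R?) .list     = filter R? (e .list)
(e ∣ R?) .unique   = Unique.filter⁺ R? (e .unique)
(e ∣ R?) .member x = mk⇔
  (λ x∈ → let x∈e , Rx = ∈-filter⁻ R? x∈ in sound e x∈e , Rx)
  (λ (Px , Rx) → ∈-filter⁺ R? (complete e Px) Rx)

infixl 5 _∣_

sumOf : (A → ℤ) → List A → ℤ
sumOf f xs = foldr ℤ._+_ 0ℤ (map f xs)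

∑ : {P : A → Set} → Enumeration P → (A → ℤ) → ℤ
∑ e f = sumOf f (e .list)

sumOf-++ : ∀ (f : A → ℤ) xs ys → sumOf f (xs ++ ys) ≡ sumOf f xs ℤ.+ sumOf f ys
sumOf-++ f []       ys = sym (ℤ.+-identityˡ _)
sumOf-++ f (x ∷ xs) ys = trans (cong (ℤ._+_ (f x)) (sumOf-++ f xs ys)) (sym (ℤ.+-assoc (f x) _ _))

-- Duplicate-free lists with the same members are permutations of each other, and addition is
-- commutative.
sumOf-unique : ∀ (f : A → ℤ) {xs ys} → Unique xs → Unique ys →
               (∀ {x} → x ∈ xs ⇔ x ∈ ys) → sumOf f xs ≡ sumOf f ys
sumOf-unique f uxs uys xs∼ys = ↭ₛ.foldr-commMonoid (setoid ℤ) ℤ.+-0-isCommutativeMonoid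
  (↭⇒↭ₛ (map⁺ f (∼bag⇒↭ (unique∧set⇒bag uxs uys xs∼ys))))

-- Injectivity is asked only on the members of `xs`: the maps used below involve truncated
-- subtraction or halving and can be undone only on solutions.
map-unique : ∀ (φ : A → B) {xs} → (∀ {x y} → x ∈ xs → y ∈ xs → φ x ≡ φ y → x ≡ y) →
             Unique xs → Unique (map φ xs)
map-unique φ inj []         = []
map-unique φ inj (x∉ ∷ uxs) =
  All.map⁺ (All.tabulate (λ y∈ → All.lookup x∉ y∈ ∘ inj (here refl) (there y∈)))
  ∷ map-unique φ (λ x∈ y∈ → inj (there x∈) (there y∈)) uxs

-- `ψφ` keeps the image of the first list duplicate-free, and `φψ` makes that image exhaust the
-- second set.
∑-reindex : ∀ {P : A → Set} {Q : B → Set} (e : Enumeration P) (e′ : Enumeration Q) {f g}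
            (φ : A → B) (ψ : B → A) →
            (∀ p → P p → Q (φ p)) → (∀ q → Q q → P (ψ q)) →
            (∀ p → P p → ψ (φ p) ≡ p) → (∀ q → Q q → φ (ψ q) ≡ q) →
            (∀ p → P p → f p ≡ g (φ p)) → ∑ e f ≡ ∑ e′ g
∑-reindex e e′ {f} {g} φ ψ φ-to ψ-to ψφ φψ f≡gφ = begin
  sumOf f (e .list)         ≡⟨ cong (foldr ℤ._+_ 0ℤ) (map-cong-local (All.tabulate (f≡gφ _ ∘ sound e))) ⟩
  sumOf (g ∘ φ) (e .list)   ≡⟨ cong (foldr ℤ._+_ 0ℤ) (map-∘ (e .list)) ⟩
  sumOf g (map φ (e .list)) ≡⟨ sumOf-unique g (map-unique φ φ-inj (e .unique)) (e′ .unique) (mk⇔ to from) ⟩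
  sumOf g (e′ .list)        ∎
  where
  open ≡-Reasoning
  φ-inj : ∀ {x y} → x ∈ e .list → y ∈ e .list → φ x ≡ φ y → x ≡ y
  φ-inj x∈ y∈ eq = trans (sym (ψφ _ (sound e x∈))) (trans (cong ψ eq) (ψφ _ (sound e y∈)))
  to : ∀ {q} → q ∈ map φ (e .list) → q ∈ e′ .list
  to q∈ with p , p∈ , refl ← ∈-map⁻ φ q∈ = complete e′ (φ-to p (sound e p∈))
  from : ∀ {q} → q ∈ e′ .list → q ∈ map φ (e .list)
  from q∈ = subst (_∈ map φ (e .list)) (φψ _ (sound e′ q∈))
                  (∈-map⁺ φ (complete e (ψ-to _ (sound e′ q∈))))

∑-cong-set : ∀ {P Q : A → Set} (e : Enumeration P) (e′ : Enumeration Q) {f} →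
             (∀ p → P p → Q p) → (∀ p → Q p → P p) → ∑ e f ≡ ∑ e′ f
∑-cong-set e e′ P⊆Q Q⊆P =
  ∑-reindex e e′ id id P⊆Q Q⊆P (λ _ _ → refl) (λ _ _ → refl) (λ _ _ → refl)

∑-dichotomy : ∀ {P R : A → Set} (e : Enumeration P) (R? : Decidable R) f →
              ∑ e f ≡ ∑ (e ∣ R?) f ℤ.+ ∑ (e ∣ ∁? R?) f
∑-dichotomy {P = P} {R} e R? f = trans
  (sumOf-unique f (e .unique) (Unique.++⁺ (e₁ .unique) (e₂ .unique) disjoint) (mk⇔ to from))
  (sumOf-++ f (e₁ .list) (e₂ .list))
  where
  e₁ = e ∣ R?
  e₂ = e ∣ ∁? R?
  disjoint : ∀ {x} → ¬ (x ∈ e₁ .list × x ∈ e₂ .list)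
  disjoint (x∈₁ , x∈₂) = proj₂ (sound e₂ x∈₂) (proj₂ (sound e₁ x∈₁))
  to : ∀ {x} → x ∈ e .list → x ∈ e₁ .list ++ e₂ .list
  to {x} x∈ with R? x
  ... | yes Rx = ∈-++⁺ˡ (complete e₁ (sound e x∈ , Rx))
  ... | no ¬Rx = ∈-++⁺ʳ (e₁ .list) (complete e₂ (sound e x∈ , ¬Rx))
  from : ∀ {x} → x ∈ e₁ .list ++ e₂ .list → x ∈ e .list
  from x∈ with ∈-++⁻ (e₁ .list) x∈
  ... | inj₁ x∈₁ = complete e (proj₁ (sound e₁ x∈₁))
  ... | inj₂ x∈₂ = complete e (proj₁ (sound e₂ x∈₂))

∑-trichotomy : ∀ {P : A → Set} (e : Enumeration P) (s t : A → ℕ) f →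
               ∑ e f ≡ ∑ (e ∣ λ x → s x <? t x) f ℤ.+
                       (∑ (e ∣ λ x → t x <? s x) f ℤ.+ ∑ (e ∣ λ x → s x ≟ t x) f)
∑-trichotomy {P = P} e s t f = trans (∑-dichotomy e s<t? f) (cong (ℤ._+_ (∑ (e ∣ s<t?) f))
  (trans (∑-dichotomy (e ∣ ∁? s<t?) t<s? f) (cong₂ ℤ._+_
    (∑-cong-set (e ∣ ∁? s<t? ∣ t<s?) (e ∣ t<s?)
      (λ _ ((Px , _) , t<s) → Px , t<s) (λ _ (Px , t<s) → (Px , <-asym t<s) , t<s))
    (∑-cong-set (e ∣ ∁? s<t? ∣ ∁? t<s?) (e ∣ λ x → s x ≟ t x)
      (λ _ ((Px , s≮t) , t≮s) → Px , ≤-antisym (≮⇒≥ t≮s) (≮⇒≥ s≮t))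
      (λ _ (Px , s≡t) → (Px , <-irrefl s≡t) , <-irrefl (sym s≡t))))))
  where
  s<t? = λ x → s x <? t x
  t<s? = λ x → t x <? s x

∑-neg : ∀ {P : A → Set} (e : Enumeration P) f → ∑ e (λ x → ℤ.- f x) ≡ ℤ.- ∑ e f
∑-neg e f = go (e .list)
  where
  go : ∀ xs → sumOf (λ x → ℤ.- f x) xs ≡ ℤ.- sumOf f xs
  go []       = refl
  go (x ∷ xs) = trans (cong (ℤ._+_ (ℤ.- f x)) (go xs)) (sym (ℤ.neg-distrib-+ (f x) _))

∑-mono-≤ : ∀ {P : A → Set} (e : Enumeration P) {f g} → (∀ x → P x → f x ℤ.≤ g x) → ∑ e f ℤ.≤ ∑ e g
∑-mono-≤ e {f} {g} f≤g = go (e .list) (All.tabulate (f≤g _ ∘ sound e))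
  where
  go : ∀ xs → All (λ x → f x ℤ.≤ g x) xs → sumOf f xs ℤ.≤ sumOf g xs
  go []       All.[]         = ℤ.≤-refl
  go (x ∷ xs) (fx≤gx All.∷ h) = ℤ.+-mono-≤ fx≤gx (go xs h)

∑-zero : ∀ {P : A → Set} (e : Enumeration P) → ∑ e (λ _ → 0ℤ) ≡ 0ℤ
∑-zero e = go (e .list)
  where
  go : ∀ xs → sumOf (λ _ → 0ℤ) xs ≡ 0ℤ
  go []       = refl
  go (x ∷ xs) = trans (ℤ.+-identityˡ _) (go xs)

∑-nonNegative : ∀ {P : A → Set} (e : Enumeration P) {f} → (∀ x → P x → 0ℤ ℤ.≤ f x) → 0ℤ ℤ.≤ ∑ e f
∑-nonNegative e {f} 0≤f = subst (λ i → i ℤ.≤ ∑ e f) (∑-zero e) (∑-mono-≤ e 0≤f)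

-- The sum over `P` moves onto the image of `φ` inside `Q`; the other terms of `Q` are nonnegative
-- and can only raise the total. Decidable equality on `B` lets the image be split off.
∑-inject : DecidableEquality B → {P : A → Set} {Q : B → Set} (e : Enumeration P) (e′ : Enumeration Q) →
           ∀ {f g} (φ : A → B) (ψ : B → A) →
           (∀ p → P p → Q (φ p)) → (∀ p → P p → ψ (φ p) ≡ p) →
           (∀ q → Q q → 0ℤ ℤ.≤ g q) →
           (∀ p → P p → f p ℤ.≤ g (φ p)) → ∑ e f ℤ.≤ ∑ e′ g
∑-inject _≟ᴮ_ {P} {Q} e e′ {f} {g} φ ψ φ-to ψφ 0≤g f≤gφ = begin
  ∑ e f                                        ≤⟨ ∑-mono-≤ e f≤gφ ⟩
  ∑ e (g ∘ φ)                                  ≡⟨ ∑-reindex e image φ ψ to from ψφ φψ (λ _ _ → refl) ⟩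
  ∑ image g                                    ≡⟨ ℤ.+-identityʳ _ ⟨
  ∑ image g ℤ.+ 0ℤ                             ≤⟨ ℤ.+-monoʳ-≤ (∑ image g) (∑-nonNegative (e′ ∣ ∁? inImage?) (λ q (Qq , _) → 0≤g q Qq)) ⟩
  ∑ image g ℤ.+ ∑ (e′ ∣ ∁? inImage?) g         ≡⟨ ∑-dichotomy e′ inImage? g ⟨
  ∑ e′ g                                       ∎
  where
  open ℤ.≤-Reasoning
  open DecMembership _≟ᴮ_ using (_∈?_)
  inImage? = λ q → q ∈? map φ (e .list)
  image = e′ ∣ inImage?
  to : ∀ p → P p → Q (φ p) × φ p ∈ map φ (e .list)
  to p Pp = φ-to p Pp , ∈-map⁺ φ (complete e Pp)
  from : ∀ q → Q q × q ∈ map φ (e .list) → P (ψ q)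
  from q (_ , q∈) with p , p∈ , refl ← ∈-map⁻ φ q∈ = subst P (sym (ψφ p (sound e p∈))) (sound e p∈)
  φψ : ∀ q → Q q × q ∈ map φ (e .list) → φ (ψ q) ≡ q
  φψ q (_ , q∈) with p , p∈ , refl ← ∈-map⁻ φ q∈ = cong φ (ψφ p (sound e p∈))

singleton : (x : A) → Enumeration (_≡ x)
singleton x .list     = x ∷ []
singleton x .unique   = All.[] ∷ []
singleton x .member y = mk⇔ (λ { (here y≡x) → y≡x ; (there ()) }) here

member-≤-∑ : DecidableEquality A → ∀ {P : A → Set} (e : Enumeration P) {f} →
             (∀ x → P x → 0ℤ ℤ.≤ f x) → ∀ {x} → P x → f x ℤ.≤ ∑ e f
member-≤-∑ _≟ᴬ_ e {f} 0≤f {x} Px = subst (λ i → i ℤ.≤ ∑ e f) (ℤ.+-identityʳ (f x))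
  (∑-inject _≟ᴬ_ (singleton x) e id id (λ { _ refl → Px }) (λ _ _ → refl) 0≤f (λ _ _ → ℤ.≤-refl))

-- Parity and signs

_≟ᵠ_ : DecidableEquality Quadruple
_≟ᵠ_ = ≡-dec _≟_ (≡-dec _≟_ (≡-dec _≟_ _≟_))

Even Odd : ℕ → Set
Even m = ∃ λ t → m ≡ 2 * t
Odd  m = ∃ λ t → m ≡ 2 * t + 1

parity : ∀ m → Even m ⊎ Odd m
parity zero = inj₁ (0 , refl)
parity (suc m) with parity m
... | inj₁ (t , refl) = inj₂ (t , +-comm 1 (2 * t))
... | inj₂ (t , refl) = inj₁ (suc t , lemma t)
  where
  lemma : ∀ t → 1 + (2 * t + 1) ≡ 2 * (1 + t)
  lemma = solve-∀

⌊2t/2⌋≡t : ∀ t → ⌊ 2 * t /2⌋ ≡ t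
⌊2t/2⌋≡t t = trans (cong (λ u → ⌊ t + u /2⌋) (+-identityʳ t)) (sym (n≡⌊n+n/2⌋ t))

⌊2t+1/2⌋≡t : ∀ t → ⌊ 2 * t + 1 /2⌋ ≡ t
⌊2t+1/2⌋≡t zero    = refl
⌊2t+1/2⌋≡t (suc t) = trans (cong ⌊_/2⌋ (lemma t)) (cong suc (⌊2t+1/2⌋≡t t))
  where
  lemma : ∀ t → 2 * (1 + t) + 1 ≡ 2 + (2 * t + 1)
  lemma = solve-∀

¬even∧odd : ∀ {m} → Even m → ¬ Odd m
¬even∧odd (t , refl) (t′ , eq) = even≢odd t t′ (trans eq (+-comm (2 * t′) 1))

even? : Decidable Even
even? m with parity m
... | inj₁ even = yes even
... | inj₂ odd  = no λ even → ¬even∧odd even odd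

¬even⇒odd : ∀ {m} → ¬ Even m → Odd m
¬even⇒odd {m} ¬even with parity m
... | inj₁ even = contradiction even ¬even
... | inj₂ odd  = odd

±_ : ℕ → ℤ
± k = -1ℤ ℤ.^ k

±-suc : ∀ k → ± suc k ≡ ℤ.- (± k)
±-suc k = ℤ.-1*i≡-i (± k)

±-double-+ : ∀ m k → ± (2 * m + k) ≡ ± k
±-double-+ zero    k = refl
±-double-+ (suc m) k = begin
  ± (2 * suc m + k)           ≡⟨ cong ±_ (lemma m k) ⟩
  ± suc (suc (2 * m + k))     ≡⟨ ±-suc (suc (2 * m + k)) ⟩
  ℤ.- (± suc (2 * m + k))     ≡⟨ cong ℤ.-_ (±-suc (2 * m + k)) ⟩
  ℤ.- (ℤ.- (± (2 * m + k)))   ≡⟨ ℤ.neg-involutive _ ⟩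
  ± (2 * m + k)               ≡⟨ ±-double-+ m k ⟩
  ± k                         ∎
  where
  open ≡-Reasoning
  lemma : ∀ m k → 2 * (1 + m) + k ≡ 2 + (2 * m + k)
  lemma = solve-∀

±-even : ∀ {m} → Even m → ± m ≡ 1ℤ
±-even (t , refl) = trans (cong ±_ (sym (+-identityʳ (2 * t)))) (±-double-+ t 0)

±-odd : ∀ {m} → Odd m → ± m ≡ -1ℤ
±-odd (t , refl) = ±-double-+ t 1

-- The two Diophantine equations

Solution : ℕ → Quadruple → Set
Solution n (x , y , r , s) = 1 ≤ x × 1 ≤ y × (2 * r + 1) * x + (2 * s + 1) * y ≡ n

-- The multiplicity data come first and the part sizes last, the reverse of `Solution`: `first` is
-- the exponent `j` of the weight, while `third` and `fourth` are part sizes.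
MixedSolution : ℕ → Quadruple → Set
MixedSolution n (j , s , x , z) = 1 ≤ j × 1 ≤ x × 1 ≤ z × 2 * j * x + (2 * s + 1) * z ≡ n

enumerate-box : ∀ n {P : Quadruple → Set} → Decidable P →
                (∀ {w x y z} → P (w , x , y , z) → w ≤ n × x ≤ n × y ≤ n × z ≤ n) → Enumeration P
enumerate-box n {P} P? bound = record
  { list   = filter P? (box n)
  ; unique = Unique.filter⁺ P? (Unique.cartesianProduct⁺ u (Unique.cartesianProduct⁺ u (Unique.cartesianProduct⁺ u u)))
  ; member = λ q → mk⇔ (proj₂ ∘ ∈-filter⁻ P? {xs = box n}) (λ Pq → ∈-filter⁺ P? (∈-box Pq) Pq)
  }
  where
  u = Unique.upTo⁺ (suc n)
  ∈-box : ∀ {q} → P q → q ∈ box n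
  ∈-box Pq = let w≤ , x≤ , y≤ , z≤ = bound Pq in
    ∈-cartesianProduct⁺ (∈-upTo⁺ (s≤s w≤)) (∈-cartesianProduct⁺ (∈-upTo⁺ (s≤s x≤))
      (∈-cartesianProduct⁺ (∈-upTo⁺ (s≤s y≤)) (∈-upTo⁺ (s≤s z≤))))

m≤[2k+1]*m : ∀ k m → m ≤ (2 * k + 1) * m
m≤[2k+1]*m k m = m≤n*m m (2 * k + 1) {{>-nonZero (m≤n+m 1 (2 * k))}}

k≤[2k+1]*m : ∀ k m → 1 ≤ m → k ≤ (2 * k + 1) * m
k≤[2k+1]*m k m 1≤m = ≤-trans (≤-trans (m≤n*m k 2) (m≤m+n (2 * k) 1))
                             (m≤m*n (2 * k + 1) m {{>-nonZero 1≤m}})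

solutions : ∀ n → Enumeration (Solution n)
solutions n = enumerate-box n
  (λ (x , y , r , s) → (1 ≤? x) ×-dec (1 ≤? y) ×-dec ((2 * r + 1) * x + (2 * s + 1) * y ≟ n))
  λ { {x} {y} {r} {s} (1≤x , 1≤y , refl) →
      m≤n⇒m≤n+o _ (m≤[2k+1]*m r x) , m≤n⇒m≤o+n _ (m≤[2k+1]*m s y) ,
      m≤n⇒m≤n+o _ (k≤[2k+1]*m r x 1≤x) , m≤n⇒m≤o+n _ (k≤[2k+1]*m s y 1≤y) }

-- Positivity makes the set finite: `1 ≤ j` bounds `x`, `1 ≤ x` bounds `j`, and `1 ≤ z` bounds `s`.
mixedSolutions : ∀ n → Enumeration (MixedSolution n)
mixedSolutions n = enumerate-box n
  (λ (j , s , x , z) → (1 ≤? j) ×-dec (1 ≤? x) ×-dec (1 ≤? z) ×-dec (2 * j * x + (2 * s + 1) * z ≟ n))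
  λ { {j} {s} {x} {z} (1≤j , 1≤x , 1≤z , refl) →
      m≤n⇒m≤n+o _ (≤-trans (m≤n*m j 2) (m≤m*n (2 * j) x {{>-nonZero 1≤x}})) ,
      m≤n⇒m≤o+n _ (k≤[2k+1]*m s z 1≤z) ,
      m≤n⇒m≤n+o _ (m≤n*m x (2 * j) {{>-nonZero (≤-trans 1≤j (m≤n*m j 2))}}) ,
      m≤n⇒m≤o+n _ (m≤[2k+1]*m s z) }

quadrupleEnumeration : ∀ n → Enumeration (Admissible n)
quadrupleEnumeration n .list   = quadruples n
quadrupleEnumeration n .unique = quadruples-unique n
quadrupleEnumeration n .member = ∈-quadruples⇔ n

-- The difference has the form `suc d`, so once it replaces a truncated subtraction its positivity
-- is immediate.
<⇒+ : ∀ {m n} → m < n → ∃ λ d → n ≡ m + suc d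
<⇒+ {m} m<n = let d , eq = m≤n⇒∃[o]m+o≡n m<n in d , trans (sym eq) (sym (+-suc m d))

first second third fourth : Quadruple → ℕ
first  (w , _ , _ , _) = w
second (_ , x , _ , _) = x
third  (_ , _ , y , _) = y
fourth (_ , _ , _ , z) = z

weight : Quadruple → ℤ
weight q = ± first q

-- Classes of solutions cut out by comparing coordinates

module _ (n : ℕ) where

  x<y : Enumeration (Solution n ∩ λ q → first q < second q)
  x<y = solutions n ∣ λ q → first q <? second q

  y<x : Enumeration (Solution n ∩ λ q → second q < first q)
  y<x = solutions n ∣ λ q → second q <? first q

  x≡y : Enumeration (Solution n ∩ λ q → first q ≡ second q)
  x≡y = solutions n ∣ λ q → first q ≟ second q

  r<s : Enumeration (Solution n ∩ λ q → third q < fourth q)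
  r<s = solutions n ∣ λ q → third q <? fourth q

  s<r : Enumeration (Solution n ∩ λ q → fourth q < third q)
  s<r = solutions n ∣ λ q → fourth q <? third q

  r≡s : Enumeration (Solution n ∩ λ q → third q ≡ fourth q)
  r≡s = solutions n ∣ λ q → third q ≟ fourth q

  s<j : Enumeration (MixedSolution n ∩ λ q → second q < first q)
  s<j = mixedSolutions n ∣ λ q → second q <? first q

  s≮j : Enumeration (MixedSolution n ∩ λ q → ¬ second q < first q)
  s≮j = mixedSolutions n ∣ ∁? (λ q → second q <? first q)

  x<z : Enumeration (MixedSolution n ∩ λ q → third q < fourth q)
  x<z = mixedSolutions n ∣ λ q → third q <? fourth q

  z<x : Enumeration (MixedSolution n ∩ λ q → fourth q < third q)
  z<x = mixedSolutions n ∣ λ q → fourth q <? third q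

  x≡z : Enumeration (MixedSolution n ∩ λ q → third q ≡ fourth q)
  x≡z = mixedSolutions n ∣ λ q → third q ≟ fourth q

  swap : Quadruple → Quadruple
  swap (x , y , r , s) = (y , x , s , r)

  swap-solution : ∀ q → Solution n q → Solution n (swap q)
  swap-solution (x , y , r , s) (1≤x , 1≤y , eq) = 1≤y , 1≤x , trans (+-comm ((2 * s + 1) * y) _) eq

  sign-swap : ∀ q → sign q ≡ sign (swap q)
  sign-swap (x , y , r , s) = cong ±_ (+-comm r s)

  ∑x<y≡a : ∑ x<y sign ≡ a n
  ∑x<y≡a = ∑-cong-set x<y (quadrupleEnumeration n)
    (λ _ ((1≤x , _ , eq) , x<y) → 1≤x , x<y , eq)
    (λ _ (1≤x , x<y , eq) → (1≤x , ≤-trans (s≤s z≤n) x<y , eq) , x<y)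

  ∑y<x≡a : ∑ y<x sign ≡ a n
  ∑y<x≡a = trans (∑-reindex y<x x<y swap swap
    (λ { q (sol , lt) → swap-solution q sol , lt }) (λ { q (sol , lt) → swap-solution q sol , lt })
    (λ _ _ → refl) (λ _ _ → refl) (λ q _ → sign-swap q)) ∑x<y≡a

  ∑r<s≡∑s<r : ∑ r<s sign ≡ ∑ s<r sign
  ∑r<s≡∑s<r = ∑-reindex r<s s<r swap swap
    (λ { q (sol , lt) → swap-solution q sol , lt }) (λ { q (sol , lt) → swap-solution q sol , lt })
    (λ _ _ → refl) (λ _ _ → refl) (λ q _ → sign-swap q)

  -- Bijections between the two equations

  -- Each copy of `y = x + z` is cut into `x` and `z`, which gives `x` the even multiplicity
  -- `2(r + s + 1)`. Under this change `x < y` becomes `1 ≤ z` and `s < j` expresses `r ≥ 0`; the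
  -- extra 1 in `j` flips the sign.
  ∑x<y≡-∑s<j : ∑ x<y sign ≡ ℤ.- ∑ s<j weight
  ∑x<y≡-∑s<j = trans (∑-reindex x<y s<j φ ψ φ-to ψ-to ψφ φψ signs) (∑-neg s<j weight)
    where
    φ ψ : Quadruple → Quadruple
    φ (x , y , r , s) = (suc s + r , s , x , y ∸ x)
    ψ (j , s , x , z) = (x , x + z , j ∸ suc s , s)
    identity : ∀ x z r s → (2 * r + 1) * x + (2 * s + 1) * (x + z) ≡ 2 * (1 + s + r) * x + (2 * s + 1) * z
    identity = solve-∀
    φ-to : ∀ q → Solution n q × first q < second q → MixedSolution n (φ q) × second (φ q) < first (φ q)
    φ-to (x , y , r , s) ((1≤x , _ , eq) , x<y) with d , refl ← <⇒+ x<y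
      rewrite m+n∸m≡n x (suc d) =
      (s≤s z≤n , 1≤x , s≤s z≤n , trans (sym (identity x (suc d) r s)) eq) , s≤s (m≤m+n s r)
    ψ-to : ∀ q → MixedSolution n q × second q < first q → Solution n (ψ q) × first (ψ q) < second (ψ q)
    ψ-to (j , s , x , z) ((_ , 1≤x , 1≤z , eq) , s<j) with r , refl ← m≤n⇒∃[o]m+o≡n s<j
      rewrite m+n∸m≡n s r =
      (1≤x , ≤-trans 1≤x (m≤m+n x z) , trans (identity x z r s) eq) , m<m+n x 1≤z
    ψφ : ∀ q → Solution n q × first q < second q → ψ (φ q) ≡ q
    ψφ (x , y , r , s) (_ , x<y) = cong₂ (λ y r → x , y , r , s) (m+[n∸m]≡n (<⇒≤ x<y)) (m+n∸m≡n s r)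
    φψ : ∀ q → MixedSolution n q × second q < first q → φ (ψ q) ≡ q
    φψ (j , s , x , z) (_ , s<j) = cong₂ (λ j z → j , s , x , z) (m+[n∸m]≡n s<j) (m+n∸m≡n x z)
    signs : ∀ q → Solution n q × first q < second q → sign q ≡ ℤ.- weight (φ q)
    signs (x , y , r , s) _ = begin
      ± (r + s)                 ≡⟨ cong ±_ (+-comm r s) ⟩
      ± (s + r)                 ≡⟨ ℤ.neg-involutive _ ⟨
      ℤ.- (ℤ.- (± (s + r)))     ≡⟨ cong ℤ.-_ (±-suc (s + r)) ⟨
      ℤ.- (± suc (s + r))       ∎
      where open ≡-Reasoning

  -- With `r = s + j`, the `2s + 1` copies of `y` absorb as many copies of `x`, leaving `2j` copies
  -- of `x`. Here `s < r` becomes `1 ≤ j` and `1 ≤ y` becomes `x < z`; the sign survives because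
  -- `r + s = 2s + j`.
  ∑s<r≡∑x<z : ∑ s<r sign ≡ ∑ x<z weight
  ∑s<r≡∑x<z = ∑-reindex s<r x<z φ ψ φ-to ψ-to ψφ φψ signs
    where
    φ ψ : Quadruple → Quadruple
    φ (x , y , r , s) = (r ∸ s , s , x , x + y)
    ψ (j , s , x , z) = (x , z ∸ x , s + j , s)
    identity : ∀ x y j s → (2 * (s + j) + 1) * x + (2 * s + 1) * y ≡ 2 * j * x + (2 * s + 1) * (x + y)
    identity = solve-∀
    φ-to : ∀ q → Solution n q × fourth q < third q → MixedSolution n (φ q) × third (φ q) < fourth (φ q)
    φ-to (x , y , r , s) ((1≤x , 1≤y , eq) , s<r) with d , refl ← <⇒+ s<r
      rewrite m+n∸m≡n s (suc d) =
      (s≤s z≤n , 1≤x , ≤-trans 1≤x (m≤m+n x y) , trans (sym (identity x y (suc d) s)) eq) , m<m+n x 1≤y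
    ψ-to : ∀ q → MixedSolution n q × third q < fourth q → Solution n (ψ q) × fourth (ψ q) < third (ψ q)
    ψ-to (j , s , x , z) ((1≤j , 1≤x , _ , eq) , x<z) with d , refl ← <⇒+ x<z
      rewrite m+n∸m≡n x (suc d) =
      (1≤x , s≤s z≤n , trans (identity x (suc d) j s) eq) , m<m+n s 1≤j
    ψφ : ∀ q → Solution n q × fourth q < third q → ψ (φ q) ≡ q
    ψφ (x , y , r , s) (_ , s<r) = cong₂ (λ y r → x , y , r , s) (m+n∸m≡n x y) (m+[n∸m]≡n (<⇒≤ s<r))
    φψ : ∀ q → MixedSolution n q × third q < fourth q → φ (ψ q) ≡ q
    φψ (j , s , x , z) (_ , x<z) = cong₂ (λ j z → j , s , x , z) (m+n∸m≡n s j) (m+[n∸m]≡n (<⇒≤ x<z))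
    signs : ∀ q → Solution n q × fourth q < third q → sign q ≡ weight (φ q)
    signs (x , y , r , s) (_ , s<r) with d , refl ← <⇒+ s<r rewrite m+n∸m≡n s (suc d) =
      trans (cong ±_ (lemma s (suc d))) (±-double-+ s (suc d))
      where
      lemma : ∀ s d → s + d + s ≡ 2 * s + d
      lemma = solve-∀

  -- When `s ≥ j`, `2j` of the copies of `z` can be merged into the `2j` copies of `x`, turning `x`
  -- into `x + z`. The value of `j`, and so the weight, is unchanged.
  ∑s≮j≡∑z<x : ∑ s≮j weight ≡ ∑ z<x weight
  ∑s≮j≡∑z<x = ∑-reindex s≮j z<x φ ψ φ-to ψ-to ψφ φψ (λ _ _ → refl)
    where
    φ ψ : Quadruple → Quadruple
    φ (j , s , x , z) = (j , s ∸ j , x + z , z)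
    ψ (j , s , x , z) = (j , j + s , x ∸ z , z)
    identity : ∀ j s x z → 2 * j * x + (2 * (j + s) + 1) * z ≡ 2 * j * (x + z) + (2 * s + 1) * z
    identity = solve-∀
    φ-to : ∀ q → MixedSolution n q × ¬ second q < first q → MixedSolution n (φ q) × fourth (φ q) < third (φ q)
    φ-to (j , s , x , z) ((1≤j , 1≤x , 1≤z , eq) , s≮j) with d , refl ← m≤n⇒∃[o]m+o≡n (≮⇒≥ s≮j)
      rewrite m+n∸m≡n j d =
      (1≤j , ≤-trans 1≤x (m≤m+n x z) , 1≤z , trans (sym (identity j d x z)) eq) , m<n+m z 1≤x
    ψ-to : ∀ q → MixedSolution n q × fourth q < third q → MixedSolution n (ψ q) × ¬ second (ψ q) < first (ψ q)
    ψ-to (j , s , x , z) ((1≤j , 1≤x , 1≤z , eq) , z<x) =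
      (1≤j , m<n⇒0<n∸m z<x , 1≤z ,
        trans (identity j s (x ∸ z) z)
              (trans (cong (λ x → 2 * j * x + (2 * s + 1) * z) (m∸n+n≡m (<⇒≤ z<x))) eq)) ,
      ≤⇒≯ (m≤m+n j s)
    ψφ : ∀ q → MixedSolution n q × ¬ second q < first q → ψ (φ q) ≡ q
    ψφ (j , s , x , z) (_ , s≮j) = cong₂ (λ s x → j , s , x , z) (m+[n∸m]≡n (≮⇒≥ s≮j)) (m+n∸n≡m x z)
    φψ : ∀ q → MixedSolution n q × fourth q < third q → φ (ψ q) ≡ q
    φψ (j , s , x , z) (_ , z<x) = cong₂ (λ s x → j , s , x , z) (m+n∸m≡n j s) (m∸n+n≡m (<⇒≤ z<x))

  -- Linear relations between the sums

  -- The full mixed sum is split once by `s` against `j` and once by `x` against `z`; the class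
  -- `z < x` occurs in both splittings and cancels.
  a≡-[∑x<z+∑x≡z] : a n ≡ ℤ.- (∑ x<z weight ℤ.+ ∑ x≡z weight)
  a≡-[∑x<z+∑x≡z] = trans (trans (sym ∑x<y≡a) ∑x<y≡-∑s<j) (cong ℤ.-_ (cancel _ _ (∑ x<z weight) (∑ x≡z weight) (begin
    ∑ s<j weight ℤ.+ ∑ z<x weight                        ≡⟨ cong (λ i → ∑ s<j weight ℤ.+ i) ∑s≮j≡∑z<x ⟨
    ∑ s<j weight ℤ.+ ∑ s≮j weight                        ≡⟨ ∑-dichotomy (mixedSolutions n) (λ q → second q <? first q) weight ⟨
    ∑ (mixedSolutions n) weight                          ≡⟨ ∑-trichotomy (mixedSolutions n) third fourth weight ⟩
    ∑ x<z weight ℤ.+ (∑ z<x weight ℤ.+ ∑ x≡z weight)     ∎)))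
    where
    open ≡-Reasoning
    cancel : ∀ q u t v → q ℤ.+ u ≡ t ℤ.+ (u ℤ.+ v) → q ≡ t ℤ.+ v
    cancel q u t v eq = ∙-cancelʳ u q (t ℤ.+ v) (trans eq (rearrange t u v))
      where
      rearrange : ∀ t u v → t ℤ.+ (u ℤ.+ v) ≡ t ℤ.+ v ℤ.+ u
      rearrange = ℤ-Ring.solve-∀

  -- Both sides are the sum over `solutions n`. In each trichotomy `swap` exchanges the two strict
  -- classes, so they contribute equally.
  2a+∑x≡y≡2∑x<z+∑r≡s : a n ℤ.+ (a n ℤ.+ ∑ x≡y sign) ≡ ∑ x<z weight ℤ.+ (∑ x<z weight ℤ.+ ∑ r≡s sign)
  2a+∑x≡y≡2∑x<z+∑r≡s = begin
    a n ℤ.+ (a n ℤ.+ ∑ x≡y sign)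
      ≡⟨ cong₂ (λ i j → i ℤ.+ (j ℤ.+ ∑ x≡y sign)) ∑x<y≡a ∑y<x≡a ⟨
    ∑ x<y sign ℤ.+ (∑ y<x sign ℤ.+ ∑ x≡y sign)
      ≡⟨ ∑-trichotomy (solutions n) first second sign ⟨
    ∑ (solutions n) sign
      ≡⟨ ∑-trichotomy (solutions n) third fourth sign ⟩
    ∑ r<s sign ℤ.+ (∑ s<r sign ℤ.+ ∑ r≡s sign)
      ≡⟨ cong₂ (λ i j → i ℤ.+ (j ℤ.+ ∑ r≡s sign)) (trans ∑r<s≡∑s<r ∑s<r≡∑x<z) ∑s<r≡∑x<z ⟩
    ∑ x<z weight ℤ.+ (∑ x<z weight ℤ.+ ∑ r≡s sign) ∎
    where open ≡-Reasoning

  4a≡∑r≡s-∑x≡y-2∑x≡z : ℤ.+ 4 ℤ.* a n ≡ ∑ r≡s sign ℤ.- ∑ x≡y sign ℤ.- ℤ.+ 2 ℤ.* ∑ x≡z weight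
  4a≡∑r≡s-∑x≡y-2∑x≡z = combine (a n) (∑ x<z weight) (∑ x≡z weight) (∑ x≡y sign) (∑ r≡s sign)
                         a≡-[∑x<z+∑x≡z] 2a+∑x≡y≡2∑x<z+∑r≡s
    where
    open ≡-Reasoning
    -- Adding `2a = 2t + d - x` to `2a = -2(t + v)` eliminates `t`.
    combine : ∀ a t v x d → a ≡ ℤ.- (t ℤ.+ v) → a ℤ.+ (a ℤ.+ x) ≡ t ℤ.+ (t ℤ.+ d) →
              ℤ.+ 4 ℤ.* a ≡ d ℤ.- x ℤ.- ℤ.+ 2 ℤ.* v
    combine a t v x d eq₁ eq₂ = begin
      ℤ.+ 4 ℤ.* a                                                    ≡⟨ step₁ a x ⟩
      (a ℤ.+ (a ℤ.+ x)) ℤ.- x ℤ.+ ℤ.+ 2 ℤ.* a                        ≡⟨ cong₂ (λ i j → i ℤ.- x ℤ.+ ℤ.+ 2 ℤ.* j) eq₂ eq₁ ⟩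
      (t ℤ.+ (t ℤ.+ d)) ℤ.- x ℤ.+ ℤ.+ 2 ℤ.* (ℤ.- (t ℤ.+ v))          ≡⟨ step₂ t v x d ⟩
      d ℤ.- x ℤ.- ℤ.+ 2 ℤ.* v                                        ∎
      where
      step₁ : ∀ a x → ℤ.+ 4 ℤ.* a ≡ (a ℤ.+ (a ℤ.+ x)) ℤ.- x ℤ.+ ℤ.+ 2 ℤ.* a
      step₁ = ℤ-Ring.solve-∀
      step₂ : ∀ t v x d → (t ℤ.+ (t ℤ.+ d)) ℤ.- x ℤ.+ ℤ.+ 2 ℤ.* (ℤ.- (t ℤ.+ v)) ≡ d ℤ.- x ℤ.- ℤ.+ 2 ℤ.* v
      step₂ = ℤ-Ring.solve-∀

  -- Sign of the diagonal `x = z`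

  -- On the diagonal only the total multiplicity `2j + 2s + 1` matters, so one unit can pass from
  -- `j` to `s`. An even positive `j` is at least 2, so `j - 1` is still admissible and is odd:
  -- every positive term is matched with its own negative one.
  ∑x≡z≤0 : ∑ x≡z weight ℤ.≤ 0ℤ
  ∑x≡z≤0 = begin
    ∑ x≡z weight                                          ≡⟨ ∑-dichotomy x≡z evenⱼ? weight ⟩
    ∑ (x≡z ∣ evenⱼ?) weight ℤ.+ ∑ (x≡z ∣ ∁? evenⱼ?) weight ≤⟨ ℤ.+-monoˡ-≤ _ even≤-odd ⟩
    ∑ (x≡z ∣ ∁? evenⱼ?) (λ q → ℤ.- weight q) ℤ.+ ∑ (x≡z ∣ ∁? evenⱼ?) weight
                                                          ≡⟨ cong (λ i → i ℤ.+ ∑ (x≡z ∣ ∁? evenⱼ?) weight) (∑-neg (x≡z ∣ ∁? evenⱼ?) weight) ⟩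
    ℤ.- ∑ (x≡z ∣ ∁? evenⱼ?) weight ℤ.+ ∑ (x≡z ∣ ∁? evenⱼ?) weight
                                                          ≡⟨ ℤ.+-inverseˡ (∑ (x≡z ∣ ∁? evenⱼ?) weight) ⟩
    0ℤ                                                    ∎
    where
    open ℤ.≤-Reasoning
    evenⱼ? : Decidable (Even ∘ first)
    evenⱼ? q = even? (first q)
    φ ψ : Quadruple → Quadruple
    φ (j , s , x , z) = (j ∸ 1 , suc s , x , z)
    ψ (j , s , x , z) = (suc j , s ∸ 1 , x , z)
    identity : ∀ j s x → 2 * j * x + (2 * (1 + s) + 1) * x ≡ 2 * (1 + j) * x + (2 * s + 1) * x
    identity = solve-∀
    suc-even : ∀ {j} → Even (suc j) → ¬ Even j
    suc-even (t , eq) (t′ , refl) = even≢odd t t′ (sym eq)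
    1≤pred : ∀ {j} → Even (suc j) → 1 ≤ j
    1≤pred {zero}  even = contradiction (0 , refl) (suc-even even)
    1≤pred {suc j} _    = s≤s z≤n
    φ-to : ∀ q → (MixedSolution n q × third q ≡ fourth q) × Even (first q) →
           (MixedSolution n (φ q) × third (φ q) ≡ fourth (φ q)) × ¬ Even (first (φ q))
    φ-to (suc j , s , x , .x) (((_ , 1≤x , 1≤z , eq) , refl) , even) =
      ((1≤pred even , 1≤x , 1≤z , trans (identity j s x) eq) , refl) , suc-even even
    ψφ : ∀ q → (MixedSolution n q × third q ≡ fourth q) × Even (first q) → ψ (φ q) ≡ q
    ψφ (suc j , s , x , z) _ = refl
    even≤-odd : ∑ (x≡z ∣ evenⱼ?) weight ℤ.≤ ∑ (x≡z ∣ ∁? evenⱼ?) (λ q → ℤ.- weight q)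
    even≤-odd = ∑-inject _≟ᵠ_ (x≡z ∣ evenⱼ?) (x≡z ∣ ∁? evenⱼ?) φ ψ φ-to ψφ
      (λ q (_ , odd) → subst (λ i → 0ℤ ℤ.≤ ℤ.- i) (sym (±-odd (¬even⇒odd odd))) (ℤ.+≤+ z≤n))
      (λ { (suc j , _) _ → ℤ.≤-reflexive (±-suc j) })

  -- Comparison of the classes `x = y` and `r = s`

  sign-r≡s : ∀ q → third q ≡ fourth q → sign q ≡ 1ℤ
  sign-r≡s (_ , _ , r , .r) refl = ±-even (r , cong (r +_) (sym (+-identityʳ r)))

  0≤sign-r≡s : ∀ q → third q ≡ fourth q → 0ℤ ℤ.≤ sign q
  0≤sign-r≡s q r≡s = subst (0ℤ ℤ.≤_) (sym (sign-r≡s q r≡s)) (ℤ.+≤+ z≤n)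

  evenₓ? : Decidable (Even ∘ first)
  evenₓ? q = even? (first q)

  evenᵣₛ? : Decidable (λ q → Even (third q + fourth q))
  evenᵣₛ? q = even? (third q + fourth q)

  -- Halving the common part `2t` doubles the total multiplicity to `4(r + s + 1)`, which is
  -- redistributed as `2r + 1` and `2(r + 2s + 1) + 1`. The new exponent `2(r + s) + 1` is odd, and
  -- `s` is recovered because the new last coordinate exceeds `r` by `2s + 1`.
  evenˣ≤-oddʳˢ : ∑ (x≡y ∣ evenᵣₛ? ∣ evenₓ?) sign ℤ.≤ ∑ (x≡y ∣ ∁? evenᵣₛ?) (λ q → ℤ.- sign q)
  evenˣ≤-oddʳˢ = ∑-inject _≟ᵠ_ (x≡y ∣ evenᵣₛ? ∣ evenₓ?) (x≡y ∣ ∁? evenᵣₛ?) φ ψ φ-to ψφ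
    (λ { q (_ , odd) → subst (λ i → 0ℤ ℤ.≤ ℤ.- i) (sym (±-odd (¬even⇒odd odd))) (ℤ.+≤+ z≤n) })
    (λ { q@(_ , _ , r , s) ((_ , even) , _) → ℤ.≤-reflexive
         (trans (±-even even) (cong ℤ.-_ (sym (±-odd (odd-φ r s))))) })
    where
    φ ψ : Quadruple → Quadruple
    φ (x , y , r , s) = (⌊ x /2⌋ , ⌊ y /2⌋ , r , r + (2 * s + 1))
    ψ (x , y , r , s) = (2 * x , 2 * y , r , ⌊ s ∸ r /2⌋)
    identity : ∀ t r s → (2 * r + 1) * t + (2 * (r + (2 * s + 1)) + 1) * t ≡
                         (2 * r + 1) * (2 * t) + (2 * s + 1) * (2 * t)
    identity = solve-∀
    odd-φ : ∀ r s → Odd (r + (r + (2 * s + 1)))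
    odd-φ r s = r + s , lemma r s
      where
      lemma : ∀ r s → r + (r + (2 * s + 1)) ≡ 2 * (r + s) + 1
      lemma = solve-∀
    1≤half : ∀ {t} → 1 ≤ 2 * t → 1 ≤ t
    1≤half {suc t} _ = s≤s z≤n
    φ-to : ∀ q → ((Solution n q × first q ≡ second q) × Even (third q + fourth q)) × Even (first q) →
           (Solution n (φ q) × first (φ q) ≡ second (φ q)) × ¬ Even (third (φ q) + fourth (φ q))
    φ-to (x , y , r , s) ((((1≤x , _ , eq) , refl) , _) , (t , refl)) rewrite ⌊2t/2⌋≡t t =
      ((1≤half 1≤x , 1≤half 1≤x , trans (identity t r s) eq) , refl) ,
      λ even → ¬even∧odd even (odd-φ r s)
    ψφ : ∀ q → ((Solution n q × first q ≡ second q) × Even (third q + fourth q)) × Even (first q) → ψ (φ q) ≡ q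
    ψφ (x , y , r , s) (((_ , refl) , _) , (t , refl))
      rewrite ⌊2t/2⌋≡t t | m+n∸m≡n r (2 * s + 1) | ⌊2t+1/2⌋≡t s = refl

  -- A solution with equal odd part size 2t+1 and multiplicities 2r+1, 2s+1 is
  -- transposed to one with part sizes 2r+1, 2s+1 of equal multiplicity 2t+1.
  oddˣ≤oddˣ : ∑ (x≡y ∣ evenᵣₛ? ∣ ∁? evenₓ?) sign ℤ.≤ ∑ (r≡s ∣ ∁? evenₓ?) sign
  oddˣ≤oddˣ = ∑-inject _≟ᵠ_ (x≡y ∣ evenᵣₛ? ∣ ∁? evenₓ?) (r≡s ∣ ∁? evenₓ?) φ φ φ-to φφ
    (λ q ((_ , r≡s) , _) → 0≤sign-r≡s q r≡s)
    (λ { (x , _) (((_ , refl) , even) , _) → ℤ.≤-reflexive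
         -- `sign` reads only the last two coordinates, so the part sizes `x , x` here merely stand
         -- in for those of the image.
         (trans (±-even even) (sym (sign-r≡s (x , x , ⌊ x /2⌋ , ⌊ x /2⌋) refl))) })
    where
    φ : Quadruple → Quadruple
    φ (x , y , r , s) = (2 * r + 1 , 2 * s + 1 , ⌊ x /2⌋ , ⌊ y /2⌋)
    φ-to : ∀ q → ((Solution n q × first q ≡ second q) × Even (third q + fourth q)) × ¬ Even (first q) →
           (Solution n (φ q) × third (φ q) ≡ fourth (φ q)) × ¬ Even (first (φ q))
    φ-to (x , y , r , s) ((((_ , _ , eq) , refl) , _) , odd) with t , refl ← ¬even⇒odd odd
      rewrite ⌊2t+1/2⌋≡t t =
      ((m≤n+m 1 (2 * r) , m≤n+m 1 (2 * s) ,
        trans (cong₂ _+_ (*-comm (2 * t + 1) (2 * r + 1)) (*-comm (2 * t + 1) (2 * s + 1))) eq) , refl) ,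
      λ even → ¬even∧odd even (r , refl)
    φφ : ∀ q → ((Solution n q × first q ≡ second q) × Even (third q + fourth q)) × ¬ Even (first q) → φ (φ q) ≡ q
    φφ (x , y , r , s) (((_ , refl) , _) , odd) with t , refl ← ¬even⇒odd odd
      rewrite ⌊2t+1/2⌋≡t t | ⌊2t+1/2⌋≡t r | ⌊2t+1/2⌋≡t s = refl

  -- The witness is `n = 2 + (n - 2)` with both multiplicities 1, so its sign is 1; `3 ≤ n` makes
  -- the second part positive. Its even first part keeps it out of the target of `oddˣ≤oddˣ`.
  1≤evenˣ : 3 ≤ n → 1ℤ ℤ.≤ ∑ (r≡s ∣ evenₓ?) sign
  1≤evenˣ 3≤n = member-≤-∑ _≟ᵠ_ (r≡s ∣ evenₓ?) (λ q ((_ , r≡s) , _) → 0≤sign-r≡s q r≡s)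
    {2 , n ∸ 2 , 0 , 0}
    (((s≤s z≤n , m<n⇒0<n∸m 3≤n ,
       trans (cong (2 +_) (*-identityˡ (n ∸ 2))) (m+[n∸m]≡n (<⇒≤ 3≤n))) , refl) , (1 , refl))

  -- The bound on `Xₑ` cancels against `X⁻`, `Xₒ` is covered by `Dₒ`, and `Dₑ` supplies the extra 1.
  1+∑x≡y≤∑r≡s : 3 ≤ n → 1ℤ ℤ.+ ∑ x≡y sign ℤ.≤ ∑ r≡s sign
  1+∑x≡y≤∑r≡s 3≤n = begin
    1ℤ ℤ.+ ∑ x≡y sign                         ≡⟨ cong (ℤ._+_ 1ℤ) (∑-dichotomy x≡y evenᵣₛ? sign) ⟩
    1ℤ ℤ.+ (∑ (x≡y ∣ evenᵣₛ?) sign ℤ.+ X⁻)    ≡⟨ cong (λ i → 1ℤ ℤ.+ (i ℤ.+ X⁻)) (∑-dichotomy (x≡y ∣ evenᵣₛ?) evenₓ? sign) ⟩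
    1ℤ ℤ.+ (Xₑ ℤ.+ Xₒ ℤ.+ X⁻)                 ≤⟨ ℤ.+-mono-≤ (1≤evenˣ 3≤n) (ℤ.+-monoˡ-≤ X⁻ (ℤ.+-mono-≤ evenˣ≤-oddʳˢ oddˣ≤oddˣ)) ⟩
    Dₑ ℤ.+ (-X⁻ ℤ.+ Dₒ ℤ.+ X⁻)                ≡⟨ cong (λ i → Dₑ ℤ.+ (i ℤ.+ Dₒ ℤ.+ X⁻)) (∑-neg (x≡y ∣ ∁? evenᵣₛ?) sign) ⟩
    Dₑ ℤ.+ (ℤ.- X⁻ ℤ.+ Dₒ ℤ.+ X⁻)             ≡⟨ cancel Dₑ X⁻ Dₒ ⟩
    Dₑ ℤ.+ Dₒ                                 ≡⟨ ∑-dichotomy r≡s evenₓ? sign ⟨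
    ∑ r≡s sign                                ∎
    where
    open ℤ.≤-Reasoning
    X⁻  = ∑ (x≡y ∣ ∁? evenᵣₛ?) sign
    -X⁻ = ∑ (x≡y ∣ ∁? evenᵣₛ?) (λ q → ℤ.- sign q)
    Xₑ  = ∑ (x≡y ∣ evenᵣₛ? ∣ evenₓ?) sign
    Xₒ  = ∑ (x≡y ∣ evenᵣₛ? ∣ ∁? evenₓ?) sign
    Dₑ  = ∑ (r≡s ∣ evenₓ?) sign
    Dₒ  = ∑ (r≡s ∣ ∁? evenₓ?) sign
    cancel : ∀ d x d′ → d ℤ.+ (ℤ.- x ℤ.+ d′ ℤ.+ x) ≡ d ℤ.+ d′
    cancel = ℤ-Ring.solve-∀

  -- Positivity and the two exceptional values

  a-positive : 3 ≤ n → 0ℤ ℤ.< a n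
  a-positive 3≤n = ℤ.*-cancelˡ-<-nonNeg (ℤ.+ 4) (begin-strict
    0ℤ                                                                <⟨ ℤ.+<+ (s≤s z≤n) ⟩
    1ℤ ℤ.+ ℤ.+ 2 ℤ.* 0ℤ                                               ≤⟨ ℤ.+-monoʳ-≤ 1ℤ (ℤ.*-monoˡ-≤-nonNeg (ℤ.+ 2) (ℤ.neg-mono-≤ ∑x≡z≤0)) ⟩
    1ℤ ℤ.+ ℤ.+ 2 ℤ.* (ℤ.- ∑ x≡z weight)                               ≡⟨ rearrange (∑ x≡y sign) (∑ x≡z weight) ⟩
    -- `∑ x≡y sign` has been added and subtracted so that the bound by `∑ r≡s sign` applies to the
    -- first two terms.
    1ℤ ℤ.+ ∑ x≡y sign ℤ.- ∑ x≡y sign ℤ.- ℤ.+ 2 ℤ.* ∑ x≡z weight        ≤⟨ ℤ.+-monoˡ-≤ (ℤ.- (ℤ.+ 2 ℤ.* ∑ x≡z weight)) (ℤ.+-monoˡ-≤ (ℤ.- ∑ x≡y sign) (1+∑x≡y≤∑r≡s 3≤n)) ⟩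
    ∑ r≡s sign ℤ.- ∑ x≡y sign ℤ.- ℤ.+ 2 ℤ.* ∑ x≡z weight              ≡⟨ 4a≡∑r≡s-∑x≡y-2∑x≡z ⟨
    ℤ.+ 4 ℤ.* a n                                                     ∎)
    where
    open ℤ.≤-Reasoning
    rearrange : ∀ x v → 1ℤ ℤ.+ ℤ.+ 2 ℤ.* (ℤ.- v) ≡ 1ℤ ℤ.+ x ℤ.- x ℤ.- ℤ.+ 2 ℤ.* v
    rearrange = ℤ-Ring.solve-∀

corollary1p2 : (n : ℕ) → 1 ≤ n → (0ℤ ℤ.≤ a n) × (a n ≡ 0ℤ ⇔ (n ≡ 1 ⊎ n ≡ 2))
-- The least admissible total is `1 + 2 = 3`, so for 1 and 2 the list `quadruples n` is empty and
-- `a n` evaluates to `0ℤ`.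
corollary1p2 1 _ = ℤ.≤-refl , mk⇔ (λ _ → inj₁ refl) (λ _ → refl)
corollary1p2 2 _ = ℤ.≤-refl , mk⇔ (λ _ → inj₂ refl) (λ _ → refl)
corollary1p2 n@(suc (suc (suc _))) _ = ℤ.<⇒≤ 0<a , mk⇔
  (λ a≡0 → contradiction (sym a≡0) (ℤ.<⇒≢ 0<a))
  (λ { (inj₁ ()) ; (inj₂ ()) })
  where
  0<a = a-positive n (s≤s (s≤s (s≤s z≤n)))
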